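{- Let $G$ be a twin-free, connected proper circular-arc graph on $n$ vertices whose complement is not bipartite. Let $\mathcal{H}'$ be the hypergraph on $V(G)$ obtained from $\mathcal{N}[G]$ by removing all hyperedges of size $n-1$. Then $\mathcal{H}'$ is twin-free and strictly overlap-connected.
   Context: Vertices $u\ne v$ of $G$ are twins if $N[u]=N[v]$. $\mathcal{N}[G]$ is the hypergraph on $V=V(G)$ with hyperedges the closed neighborhoods $N[v]$. A PCA graph is one having a representation by arcs of a circle, adjacency meaning intersection, in which no arc is contained in another. In a hypergraph, two distinct vertices are twins if every hyperedge contains both or neither. Sets $A,B\subseteq V$ strictly overlap if $A\cap B\neq\emptyset$, neither contains the other, and $A\cup B\neq V$. A hypergraph on $V$ is strictly overlap-connected if every vertex lies in some hyperedge and the graph on the hyperedges with adjacency meaning strict overlap is connected.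
   Formalization: The arcs of the proper circular-arc representation are closed arcs with rational endpoints on a circle of rational points; for finite graphs this gives the same class of PCA graphs, by an order-preserving perturbation of endpoints. -}

module Defs where

open import Data.Nat using (ℕ; _∸_)
open import Data.Bool using (Bool; true; false; _∨_; if_then_else_)
open import Data.Fin using (Fin)
open import Data.Fin.Properties using (_≟_)
open import Data.Fin.Subset using (Subset; inside; outside; _∈_; _⊆_; _∩_; _∪_; ⊤; Nonempty; ∣_∣)
open import Data.Vec using (tabulate)
open import Data.Rational using (ℚ; 0ℚ; 1ℚ; _≤_; _<_)
open import Data.Product using (Σ; ∃; _×_; _,_)
open import Data.Sum using (_⊎_)
open import Relation.Nullary using (¬_; does)
open import Relation.Binary.PropositionalEquality using (_≡_; _≢_)
open import Function.Bundles using (_⇔_)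

record Graph (n : ℕ) : Set where
  field
    adj   : Fin n → Fin n → Bool
    sym   : ∀ u v → adj u v ≡ adj v u
    irrfl : ∀ v → adj v v ≡ false
open Graph public

Adj : ∀ {n} → Graph n → Fin n → Fin n → Set
Adj G u v = adj G u v ≡ true

N[_]_ : ∀ {n} → Graph n → Fin n → Subset n
N[ G ] v = tabulate (λ u → if does (u ≟ v) ∨ adj G u v then inside else outside)

TwinFreeGraph : ∀ {n} → Graph n → Set
TwinFreeGraph {n} G = (u v : Fin n) → u ≢ v → N[ G ] u ≢ N[ G ] v

data Walk {n} (G : Graph n) : Fin n → Fin n → Set where
  here : ∀ {u} → Walk G u u
  step : ∀ {u v w} → Adj G u v → Walk G v w → Walk G u w

Connected : ∀ {n} → Graph n → Set
Connected {n} G = (u v : Fin n) → Walk G u v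

ComplementBipartite : ∀ {n} → Graph n → Set
ComplementBipartite {n} G =
  Σ (Fin n → Bool) λ c → (u v : Fin n) → u ≢ v → ¬ Adj G u v → c u ≢ c v

-- Circular-arc models.  The circle is [0,1) (with 0 identified with 1);
-- points are rationals x with 0 ≤ x < 1.  An arc (s , e) is the closed
-- clockwise arc from s to e: [s,e] if s ≤ e, and [s,1) ∪ [0,e] if e < s.

OnCircle : ℚ → Set
OnCircle x = (0ℚ ≤ x) × (x < 1ℚ)

record Arc : Set where
  field
    start  : ℚ
    end    : ℚ
    startC : OnCircle start
    endC   : OnCircle end
open Arc public

InArc : ℚ → Arc → Set
InArc x a = ((start a ≤ end a) × (start a ≤ x) × (x ≤ end a))
          ⊎ ((end a < start a) × ((start a ≤ x) ⊎ (x ≤ end a)))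

ArcSubset : Arc → Arc → Set
ArcSubset a b = (x : ℚ) → OnCircle x → InArc x a → InArc x b

ArcsIntersect : Arc → Arc → Set
ArcsIntersect a b = ∃ λ x → OnCircle x × InArc x a × InArc x b

IsPCA : ∀ {n} → Graph n → Set
IsPCA {n} G = Σ (Fin n → Arc) λ A →
    ((u v : Fin n) → u ≢ v → (Adj G u v ⇔ ArcsIntersect (A u) (A v)))
  × ((u v : Fin n) → u ≢ v → ¬ ArcSubset (A u) (A v))

Hypergraph : ℕ → Set₁
Hypergraph n = Subset n → Set

H′ : ∀ {n} → Graph n → Hypergraph n
H′ {n} G E = ∃ λ v → (E ≡ N[ G ] v) × (∣ E ∣ ≢ n ∸ 1)

TwinFreeHyp : ∀ {n} → Hypergraph n → Set
TwinFreeHyp {n} H = (u v : Fin n) → u ≢ v →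
  ∃ λ E → H E × ¬ ((u ∈ E) ⇔ (v ∈ E))

StrictlyOverlap : ∀ {n} → Subset n → Subset n → Set
StrictlyOverlap A B = Nonempty (A ∩ B) × ¬ (A ⊆ B) × ¬ (B ⊆ A) × (A ∪ B ≢ ⊤)

data OverlapPath {n} (H : Hypergraph n) : Subset n → Subset n → Set where
  here : ∀ {E} → OverlapPath H E E
  step : ∀ {E F K} → H F → StrictlyOverlap E F → OverlapPath H F K →
         OverlapPath H E K

StrictlyOverlapConnected : ∀ {n} → Hypergraph n → Set
StrictlyOverlapConnected {n} H =
    ((v : Fin n) → ∃ λ E → H E × v ∈ E)
  × ((E F : Subset n) → H E → H F → OverlapPath H E F)

{-# OPTIONS --safe #-}
-- Unroll the circle: in the universal cover the starting points of the arcs form a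
-- discrete line on which every closed neighbourhood is an interval, and the absence of a
-- partition into two cliques says that i ⇒ j and j+1 ⇒ k never cover a full turn.
-- Hence consecutive vertices i, i+1 always have a common non-neighbour, so N[i] and
-- N[i+1] overlap strictly unless they are nested; in the nested case a short path through
-- the neighbourhoods of one or two further vertices joins them, found by looking at the
-- two ends of the interval N[i+1].  A vertex d whose neighbourhood misses a
-- single vertex x can be skipped: N[d-1] and N[d+1] also miss x, cover N[d] and, by
-- twin-freeness, overlap strictly.  The same two sets replace N[d] in separating twins.
module Submission where

open import Defs
open import Data.Nat using (ℕ; zero; suc; _+_; _∸_; _≤_; s≤s)
import Data.Nat.Properties as ℕ
open import Data.Bool using (true; false; _∨_; if_then_else_)
import Data.Bool.Properties as Bool
open import Data.Fin using (Fin; zero; suc)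
open import Data.Fin.Induction using (spo-noetherian)
open import Data.Fin.Properties using (_≟_; any?)
open import Data.Fin.Subset using (Subset; inside; outside; _∈_; _∉_; _⊆_; _∪_; ∁; ⁅_⁆; ∣_∣)
open import Data.Fin.Subset.Properties using (⊆-antisym; ∈⊤; ∣⊤∣≡n; ∣⁅x⁆∣≡1; x∈⁅x⁆; x∈⁅y⁆⇒x≡y;
  p⊂q⇒∣p∣<∣q∣; p⊆q⇒∣p∣≤∣q∣; ∣∁p∣≡n∸∣p∣; x∈∁p⇒x∉p; x∈p∩q⁺; x∈p∪q⁺; x∈p∪q⁻; p⊆p∪q; ∩-comm; ∪-comm)
open import Data.Integer as ℤ using (ℤ; 0ℤ)
import Data.Integer.Properties as ℤ
open import Data.Rational as ℚ using (ℚ)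
import Data.Rational.Properties as ℚ
open import Data.Vec using (lookup)
open import Data.Vec.Properties using (lookup∘tabulate; []=⇒lookup; lookup⇒[]=)
open import Data.Product using (∃; _×_; _,_; proj₁; proj₂)
open import Data.Sum using (_⊎_; inj₁; inj₂; reduce)
open import Data.Empty using (⊥; ⊥-elim)
open import Data.Unit using (tt)
open import Function.Base using (flip)
open import Function.Bundles using (_⇔_; Equivalence)
open import Induction.WellFounded using (Acc; acc; WellFounded)
open import Relation.Nullary using (¬_; Dec; yes; no; does; contradiction)
open import Relation.Nullary.Decidable using (_⊎-dec_; _×-dec_; ¬?; decidable-stable)
open import Relation.Binary.Definitions using (tri<; tri≈; tri>)
open import Relation.Binary.PropositionalEquality as ≡ using (_≡_; _≢_; refl; cong; subst; subst₂; trans)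
open import Relation.Binary.Structures using (IsStrictPartialOrder)

-- Closed neighbourhoods, kept hyperedges and overlap paths.

module Neighbourhoods {n : ℕ} (G : Graph n) where

  Near : Fin n → Fin n → Set
  Near u v = u ≡ v ⊎ Adj G u v

  near? : ∀ u v → Dec (Near u v)
  near? u v = (u ≟ v) ⊎-dec (adj G u v Bool.≟ true)

  near-sym : ∀ {u v} → Near u v → Near v u
  near-sym (inj₁ eq) = inj₁ (≡.sym eq)
  near-sym {u} {v} (inj₂ a) = inj₂ (trans (Graph.sym G v u) a)

  private
    lookup-N : ∀ u v → lookup (N[ G ] v) u ≡ (if does (u ≟ v) ∨ adj G u v then inside else outside)
    lookup-N u v = lookup∘tabulate _ u

  near⇒∈ : ∀ {u v} → Near u v → v ∈ N[ G ] u
  near⇒∈ {u} {v} h = lookup⇒[]= v _ (trans (lookup-N v u) (val (near-sym h)))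
    where
    val : Near v u → (if does (v ≟ u) ∨ adj G v u then inside else outside) ≡ inside
    val h with v ≟ u
    val h | yes _ = refl
    val (inj₁ eq) | no v≢u = contradiction eq v≢u
    val (inj₂ a) | no _ rewrite a = refl

  ∈⇒near : ∀ {u v} → v ∈ N[ G ] u → Near u v
  ∈⇒near {u} {v} m = near-sym (val (trans (≡.sym (lookup-N v u)) ([]=⇒lookup m)))
    where
    val : (if does (v ≟ u) ∨ adj G v u then inside else outside) ≡ inside → Near v u
    val h with v ≟ u
    val h | yes eq = inj₁ eq
    val h | no _ with adj G v u
    val h | no _ | true = inj₂ refl
    val () | no _ | false

  near-⊆? : ∀ u v → (∃ λ x → Near u x × ¬ Near v x) ⊎ (∀ {x} → Near u x → Near v x)
  near-⊆? u v with any? (λ x → near? u x ×-dec ¬? (near? v x))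
  ... | yes p = inj₁ p
  ... | no np = inj₂ λ {x} h → decidable-stable (near? v x) (λ nh → np (x , h , nh))

  separated : TwinFreeGraph G → ∀ {u v} → u ≢ v →
    (∃ λ x → Near u x × ¬ Near v x) ⊎ (∃ λ x → Near v x × ¬ Near u x)
  separated tf {u} {v} u≢v with near-⊆? u v | near-⊆? v u
  ... | inj₁ p | _ = inj₁ p
  ... | inj₂ _ | inj₁ q = inj₂ q
  ... | inj₂ s | inj₂ t = contradiction
    (⊆-antisym (λ m → near⇒∈ (s (∈⇒near m))) (λ m → near⇒∈ (t (∈⇒near m)))) (tf u v u≢v)

  -- Strict overlap of N[u] and N[v] with a witness for each of its four conditions, the form in
  -- which positions on the circle supply it.
  Cross : Fin n → Fin n → Set
  Cross u v = (∃ λ x → Near u x × Near v x) × (∃ λ x → Near u x × ¬ Near v x)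
            × (∃ λ x → Near v x × ¬ Near u x) × (∃ λ x → ¬ Near u x × ¬ Near v x)

  cross-sym : ∀ {u v} → Cross u v → Cross v u
  cross-sym ((x , a , b) , p , q , (y , c , d)) = (x , b , a) , q , p , (y , d , c)

  cross⇒overlap : ∀ {u v} → Cross u v → StrictlyOverlap (N[ G ] u) (N[ G ] v)
  cross⇒overlap {u} {v} ((x , a , b) , (y , c , d) , (z , e , f) , (t , g , h)) =
      (x , x∈p∩q⁺ (near⇒∈ a , near⇒∈ b))
    , (λ s → d (∈⇒near (s (near⇒∈ c))))
    , (λ s → f (∈⇒near (s (near⇒∈ e))))
    , λ eq → out (x∈p∪q⁻ (N[ G ] u) (N[ G ] v) (subst (t ∈_) (≡.sym eq) ∈⊤))
    where
    out : t ∈ N[ G ] u ⊎ t ∈ N[ G ] v → ⊥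
    out (inj₁ m) = g (∈⇒near m)
    out (inj₂ m) = h (∈⇒near m)

  Kept : Fin n → Set
  Kept v = ∣ N[ G ] v ∣ ≢ n ∸ 1

  -- Adjoining `x` enlarges N[v], and the result still misses `y`, so N[v] has at most n - 2
  -- elements.
  two-far⇒kept : ∀ {v x y} → x ≢ y → ¬ Near v x → ¬ Near v y → Kept v
  two-far⇒kept {v} {x} {y} x≢y nx ny eq =
    ℕ.<-irrefl (cong suc eq) (ℕ.≤-trans (s≤s (p⊂q⇒∣p∣<∣q∣ (p⊆p∪q ⁅ x ⁆ ,
      x , x∈p∪q⁺ (inj₂ (x∈⁅x⁆ x)) , λ m → nx (∈⇒near m)))) lt)
    where
    A = N[ G ] v
    y∉ : y ∉ A ∪ ⁅ x ⁆
    y∉ m with x∈p∪q⁻ A ⁅ x ⁆ m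
    ... | inj₁ m₁ = ny (∈⇒near m₁)
    ... | inj₂ m₂ = x≢y (≡.sym (x∈⁅y⁆⇒x≡y x m₂))
    -- Writing `suc (n ∸ 1)` for the bound `n` matches the truncated subtraction in `Kept`.
    lt : suc ∣ A ∪ ⁅ x ⁆ ∣ ≤ suc (n ∸ 1)
    lt = ℕ.≤-trans (subst (suc ∣ A ∪ ⁅ x ⁆ ∣ ≤_) (∣⊤∣≡n n)
           (p⊂q⇒∣p∣<∣q∣ ((λ _ → ∈⊤) , y , ∈⊤ , y∉))) (ℕ.m≤n+m∸n n 1)

  -- Otherwise the complement of N[v] is the singleton of `x`, which forces the removed size n - 1.
  kept⇒two-far : ∀ {v x} → Kept v → ¬ Near v x → ∃ λ y → y ≢ x × ¬ Near v y
  kept⇒two-far {v} {x} kept nx with any? (λ y → ¬? (y ≟ x) ×-dec ¬? (near? v y))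
  ... | yes p = p
  ... | no np = contradiction (ℕ.≤-antisym upper lower) kept
    where
    A = N[ G ] v
    upper : ∣ A ∣ ≤ n ∸ 1
    upper = ℕ.∸-monoˡ-≤ 1 (subst (suc ∣ A ∣ ≤_) (∣⊤∣≡n n)
      (p⊂q⇒∣p∣<∣q∣ ((λ _ → ∈⊤) , x , ∈⊤ , λ m → nx (∈⇒near m))))
    only : ∁ A ⊆ ⁅ x ⁆
    only {y} m with y ≟ x
    ... | yes refl = x∈⁅x⁆ x
    ... | no y≢x = contradiction (y , y≢x , λ h → x∈∁p⇒x∉p m (near⇒∈ h)) np
    lower : n ∸ 1 ≤ ∣ A ∣
    lower = ℕ.m≤n+o⇒m∸n≤o n 1 (ℕ.≤-trans (ℕ.m≤n+m∸n n ∣ A ∣)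
      (subst (∣ A ∣ + (n ∸ ∣ A ∣) ≤_) (ℕ.+-comm ∣ A ∣ 1) (ℕ.+-monoʳ-≤ ∣ A ∣
        (subst (_≤ 1) (∣∁p∣≡n∸∣p∣ A)
          (subst (∣ ∁ A ∣ ≤_) (∣⁅x⁆∣≡1 x) (p⊆q⇒∣p∣≤∣q∣ only))))))

  -- A vertex of N[u] outside N[v] and a vertex outside both are two distinct vertices missed by
  -- N[v].
  cross⇒kept : ∀ {u v} → Cross u v → Kept v
  cross⇒kept (_ , (y , ny , my) , _ , (t , nt , mt)) =
    two-far⇒kept (λ { refl → nt ny }) my mt

  Path : Fin n → Fin n → Set
  Path u v = OverlapPath (H′ G) (N[ G ] u) (N[ G ] v)

  kept⇒H′ : ∀ {v} → Kept v → H′ G (N[ G ] v)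
  kept⇒H′ {v} k = v , refl , k

  _◅_ : ∀ {u v w} → Cross u v → Path v w → Path u w
  c ◅ p = step (kept⇒H′ (cross⇒kept c)) (cross⇒overlap c) p

  overlap-sym : ∀ {A B : Subset n} → StrictlyOverlap A B → StrictlyOverlap B A
  overlap-sym {A} {B} ((x , m) , a , b , u) =
    (x , subst (x ∈_) (∩-comm A B) m) , b , a , λ eq → u (trans (∪-comm A B) eq)

  path-++ : ∀ {H : Hypergraph n} {A B C} → OverlapPath H A B → OverlapPath H B C → OverlapPath H A C
  path-++ here q = q
  path-++ (step h o p) q = step h o (path-++ p q)

  -- An `OverlapPath` certifies every set except its first, so a reversed path, which ends in `A`,
  -- needs `H A`.
  path-reverse : ∀ {H : Hypergraph n} {A B} → H A → OverlapPath H A B → OverlapPath H B A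
  path-reverse hA here = here
  path-reverse hA (step h o p) =
    path-++ (path-reverse h p) (step hA (overlap-sym o) here)

-- Iterated steps and the abstract universal cover.

data Reach {A : Set} (f : A → A) : A → A → Set where
  here : ∀ {x} → Reach f x x
  next : ∀ {x y} → Reach f (f x) y → Reach f x y

reach-trans : ∀ {A : Set} {f : A → A} {x y z} → Reach f x y → Reach f y z → Reach f x z
reach-trans here s = s
reach-trans (next r) s = next (reach-trans r s)

reach-reverse : ∀ {A : Set} {f g : A → A} → (∀ x → g (f x) ≡ x) →
  ∀ {x y} → Reach f x y → Reach g y x
reach-reverse gf here = here
reach-reverse {g = g} gf {x} (next r) = reach-trans (reach-reverse gf r)
  (next (subst (λ z → Reach g z x) (≡.sym (gf x)) here))

-- A discrete intermediate value principle; it locates the ends of the interval formed by a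
-- neighbourhood.
last : ∀ {A : Set} {f : A → A} (Q : A → Set) (Q? : ∀ x → Dec (Q x)) →
  ∀ {x y} → Reach f x y → Q x → ¬ Q y → ∃ λ z → Q z × ¬ Q (f z)
last Q Q? here q nq = contradiction q nq
last {f = f} Q Q? {x} (next r) q nq with Q? (f x)
... | yes q′ = last Q Q? r q′ nq
... | no nq′ = x , q , nq′

-- The universal cover of the circle: P consists of the lifts of the starting points
-- of the arcs, succ and prec are the neighbouring positions, up and dn the two
-- deck transformations by one turn, and x ⇒ y says that x ≼ y and that the arc
-- starting at x reaches the starting point y.
record RoundModel {n : ℕ} (G : Graph n) : Set₁ where
  open Neighbourhoods G
  infix 4 _≼_ _⇒_
  field
    P : Set
    _≼_ _⇒_ : P → P → Set
    vtx : P → Fin n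
    succ prec up dn : P → P
    nextV prevV : Fin n → Fin n
    vtx-succ : ∀ x → vtx (succ x) ≡ nextV (vtx x)
    vtx-prec : ∀ x → vtx (prec x) ≡ prevV (vtx x)
    vtx-up : ∀ x → vtx (up x) ≡ vtx x
    ≼-refl : ∀ {x} → x ≼ x
    ≼-trans : ∀ {x y z} → x ≼ y → y ≼ z → x ≼ z
    ≼-antisym : ∀ {x y} → x ≼ y → y ≼ x → x ≡ y
    ≼-cmp : ∀ x y → x ≼ y ⊎ succ y ≼ x
    ≼-succ : ∀ x → x ≼ succ x
    succ-⋠ : ∀ {x} → ¬ succ x ≼ x
    succ-mono : ∀ {x y} → x ≼ y → succ x ≼ succ y
    prec-mono : ∀ {x y} → x ≼ y → prec x ≼ prec y
    succ-prec : ∀ x → succ (prec x) ≡ x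
    prec-succ : ∀ x → prec (succ x) ≡ x
    up-mono : ∀ {x y} → x ≼ y → up x ≼ up y
    dn-mono : ∀ {x y} → x ≼ y → dn x ≼ dn y
    up-dn : ∀ x → up (dn x) ≡ x
    dn-up : ∀ x → dn (up x) ≡ x
    up-succ : ∀ x → up (succ x) ≡ succ (up x)
    succ-≼-up : ∀ x → succ x ≼ up x
    reach : ∀ {x y} → x ≼ y → y ≼ up x → Reach succ x y
    lift : ∀ x v → ∃ λ y → x ≼ y × succ y ≼ up x × vtx y ≡ v
    lift-unique : ∀ {x y} → x ≼ y → succ y ≼ up x → vtx x ≡ vtx y → x ≡ y
    _⇒?_ : ∀ x y → Dec (x ⇒ y)
    ⇒-refl : ∀ {x} → x ⇒ x
    ⇒-≼ : ∀ {x y} → x ⇒ y → x ≼ y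
    ⇒-sub : ∀ {x x′ y y′} → x ≼ x′ → x′ ≼ y′ → y′ ≼ y → x ⇒ y → x′ ⇒ y′
    ⇒-up : ∀ {x y} → x ⇒ y → up x ⇒ up y
    ⇒-dn : ∀ {x y} → x ⇒ y → dn x ⇒ dn y
    ⇒-near : ∀ {x y} → x ⇒ y → Near (vtx x) (vtx y)
    near-⇒ : ∀ {x y} → x ≼ y → y ≼ up x → Near (vtx x) (vtx y) → x ⇒ y ⊎ y ⇒ up x

-- Reversing the orientation of the circle gives a model again, so an argument for N[i] inside
-- N[i+1] also serves N[i+1] inside N[i].
mirror : ∀ {n} {G : Graph n} → RoundModel G → RoundModel G
mirror {G = G} M = record
  { P = P
  ; _≼_ = λ x y → y ≼ x
  ; _⇒_ = λ x y → y ⇒ x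
  ; vtx = vtx
  ; succ = prec ; prec = succ ; up = dn ; dn = up ; nextV = prevV ; prevV = nextV
  ; vtx-succ = vtx-prec
  ; vtx-prec = vtx-succ
  ; vtx-up = vtx-dn
  ; ≼-refl = ≼-refl
  ; ≼-trans = λ p q → ≼-trans q p
  ; ≼-antisym = λ p q → ≼-antisym q p
  ; ≼-cmp = cmp
  ; ≼-succ = λ x → subst (prec x ≼_) (succ-prec x) (≼-succ (prec x))
  ; succ-⋠ = λ {x} p → succ-⋠ (subst (succ x ≼_) (succ-prec x) (succ-mono p))
  ; succ-mono = prec-mono
  ; prec-mono = succ-mono
  ; succ-prec = prec-succ
  ; prec-succ = succ-prec
  ; up-mono = dn-mono
  ; dn-mono = up-mono
  ; up-dn = dn-up
  ; dn-up = up-dn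
  ; up-succ = dn-prec
  ; succ-≼-up = λ x → ≼prec (subst (succ (dn x) ≼_) (up-dn x) (succ-≼-up (dn x)))
  ; reach = λ {x} {y} y≼x dnx≼y → reach-reverse prec-succ (reach y≼x (up-flip dnx≼y))
  ; lift = lift′
  ; lift-unique = λ {x} {y} y≼x p eq → ≡.sym (lift-unique y≼x
      (subst₂ _≼_ (cong succ (up-dn x)) (trans (≡.sym (up-succ (prec y))) (cong up (succ-prec y)))
        (succ-mono (up-mono p))) (≡.sym eq))
  ; _⇒?_ = λ x y → y ⇒? x
  ; ⇒-refl = ⇒-refl
  ; ⇒-≼ = ⇒-≼
  ; ⇒-sub = λ a b c → ⇒-sub c b a
  ; ⇒-up = ⇒-dn
  ; ⇒-dn = ⇒-up
  ; ⇒-near = λ h → near-sym (⇒-near h)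
  ; near-⇒ = near-⇒′
  }
  where
  open Neighbourhoods G
  open RoundModel M
  vtx-dn : ∀ x → vtx (dn x) ≡ vtx x
  vtx-dn x = trans (≡.sym (vtx-up (dn x))) (cong vtx (up-dn x))
  ≼prec : ∀ {x y} → succ x ≼ y → x ≼ prec y
  ≼prec {x} p = subst (_≼ _) (prec-succ x) (prec-mono p)
  cmp : ∀ x y → y ≼ x ⊎ x ≼ prec y
  cmp x y with ≼-cmp y x
  ... | inj₁ p = inj₁ p
  ... | inj₂ p = inj₂ (≼prec p)
  up-flip : ∀ {x y} → dn x ≼ y → x ≼ up y
  up-flip {x} p = subst (_≼ _) (up-dn x) (up-mono p)
  dn-prec : ∀ x → dn (prec x) ≡ prec (dn x)
  dn-prec x = trans (≡.sym (prec-succ _)) (cong prec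
    (trans (≡.sym (dn-up _)) (cong dn (trans (up-succ _) (trans (cong succ (up-dn _)) (succ-prec x))))))
  lift′ : ∀ x v → ∃ λ y → y ≼ x × dn x ≼ prec y × vtx y ≡ v
  lift′ x v with lift (succ (dn x)) v
  ... | y , p , q , eq = y
      , subst₂ _≼_ (prec-succ y) (trans (cong prec (trans (up-succ _) (cong succ (up-dn x)))) (prec-succ x))
          (prec-mono q)
      , ≼prec p , eq
  near-⇒′ : ∀ {x y} → y ≼ x → dn x ≼ y → Near (vtx x) (vtx y) → y ⇒ x ⊎ dn x ⇒ y
  near-⇒′ {x} {y} y≼x p h with near-⇒ y≼x (up-flip p) (near-sym h)
  ... | inj₁ r = inj₁ r
  ... | inj₂ r = inj₂ (subst (dn x ⇒_) (dn-up y) (⇒-dn r))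

-- Neighbourhoods of consecutive positions.

module Overlaps {n : ℕ} (G : Graph n) (tf : TwinFreeGraph G) (conn : Connected G)
                (ncb : ¬ ComplementBipartite G) (M : RoundModel G) where
  open Neighbourhoods G
  open RoundModel M

  infixr 5 _∙_
  _∙_ : ∀ {x y z} → x ≼ y → y ≼ z → x ≼ z
  _∙_ = ≼-trans

  near-refl : ∀ {v} → Near v v
  near-refl = inj₁ refl

  vtx-dn : ∀ x → vtx (dn x) ≡ vtx x
  vtx-dn x = trans (≡.sym (vtx-up (dn x))) (cong vtx (up-dn x))

  ≼-up : ∀ x → x ≼ up x
  ≼-up x = ≼-succ x ∙ succ-≼-up x

  ⇒-up⁻ : ∀ {x y} → up x ⇒ up y → x ⇒ y
  ⇒-up⁻ {x} {y} h = subst₂ _⇒_ (dn-up x) (dn-up y) (⇒-dn h)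

  succ-cancel : ∀ {x y} → succ x ≼ succ y → x ≼ y
  succ-cancel {x} {y} p = subst₂ _≼_ (prec-succ x) (prec-succ y) (prec-mono p)

  far : ∀ {x y} → x ≼ y → y ≼ up x → ¬ x ⇒ y → ¬ y ⇒ up x → ¬ Near (vtx x) (vtx y)
  far p q n m h with near-⇒ p q h
  ... | inj₁ r = n r
  ... | inj₂ r = m r

  -- Colour a vertex by whether its lift in [i , up i) is ≼ j: both classes are cliques.
  not-two-cliques : ∀ {i j k} → i ⇒ j → succ j ⇒ k → up i ≼ succ k → ⊥
  not-two-cliques {i} {j} {k} i⇒j j⇒k i≼k = ncb (colour , proper)
    where
    below : ∀ v → Dec (proj₁ (lift i v) ⇒ j)
    below v = proj₁ (lift i v) ⇒? j
    colour = λ v → does (below v)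
    adjacent : ∀ {x y} u v → vtx x ≡ u → vtx y ≡ v → x ⇒ y ⊎ y ⇒ x → Near u v
    adjacent u v refl refl (inj₁ h) = ⇒-near h
    adjacent u v refl refl (inj₂ h) = near-sym (⇒-near h)
    nonadj : ∀ {u v} → u ≢ v → ¬ Adj G u v → ¬ Near u v
    nonadj u≢v na (inj₁ eq) = u≢v eq
    nonadj u≢v na (inj₂ a) = na a
    clique : ∀ {l r x y} → l ⇒ r → l ≼ x → x ≼ r → l ≼ y → y ≼ r → x ⇒ y ⊎ y ⇒ x
    clique {x = x} {y} h lx xr ly yr with ≼-cmp x y
    ... | inj₁ p = inj₁ (⇒-sub lx p yr h)
    ... | inj₂ p = inj₂ (⇒-sub ly (≼-succ y ∙ p) xr h)
    above : ∀ {x} → i ≼ x → ¬ x ⇒ j → succ j ≼ x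
    above {x} ix nx with ≼-cmp x j
    ... | inj₁ p = contradiction (⇒-sub ix p ≼-refl i⇒j) nx
    ... | inj₂ p = p
    proper : ∀ u v → u ≢ v → ¬ Adj G u v → colour u ≢ colour v
    proper u v u≢v na same with lift i u | lift i v | below u | below v
    ... | x , ix , xi , ex | y , iy , yi , ey | yes bx | yes by =
      nonadj u≢v na (adjacent u v ex ey (clique i⇒j ix (⇒-≼ bx) iy (⇒-≼ by)))
    ... | x , ix , xi , ex | y , iy , yi , ey | no bx | no by =
      nonadj u≢v na (adjacent u v ex ey (clique j⇒k (above ix bx) (succ-cancel (xi ∙ i≼k))
        (above iy by) (succ-cancel (yi ∙ i≼k))))
    ... | _ | _ | yes _ | no _ = contradiction same λ ()
    ... | _ | _ | no _ | yes _ = contradiction same λ ()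

  -- The positions from `x` to `up x` would form a clique containing every vertex; the single
  -- position after `up x` serves as second clique.
  ⇏-up : ∀ {x} → ¬ x ⇒ up x
  ⇏-up {x} h = not-two-cliques h ⇒-refl (≼-succ _ ∙ ≼-succ _)

  ⇒⇒≼-up : ∀ {x y} → x ⇒ y → succ y ≼ up x
  ⇒⇒≼-up {x} {y} h with ≼-cmp (up x) y
  ... | inj₁ p = contradiction (⇒-sub ≼-refl (≼-up x) p h) ⇏-up
  ... | inj₂ p = p

  last-⇒ : ∀ x → ∃ λ y → x ⇒ y × ¬ x ⇒ succ y
  last-⇒ x = last (x ⇒_) (x ⇒?_) (reach (≼-up x) ≼-refl) ⇒-refl ⇏-up

  -- The search runs from `dn x`, which by `⇏-up` does not reach `x`, up to `x`; `succ y` is the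
  -- left end of the interval N[x].
  first-⇒ : ∀ x → ∃ λ y → succ y ⇒ x × ¬ y ⇒ x
  first-⇒ x with last (λ y → ¬ y ⇒ x) (λ y → ¬? (y ⇒? x))
       (reach (subst (dn x ≼_) (up-dn x) (≼-up (dn x))) (subst (x ≼_) (≡.sym (up-dn x)) ≼-refl))
       (λ h → ⇏-up (subst (dn x ⇒_) (≡.sym (up-dn x)) h)) (λ n → n ⇒-refl)
  ... | y , n , nn = y , decidable-stable (succ y ⇒? x) nn , n

  -- If either part failed, [succ i , c] alone or together with [succ c , up i] would cover a full
  -- turn by at most two cliques.
  beyond : ∀ {i c} → succ i ⇒ c → succ c ≼ up i × ¬ succ c ⇒ up i
  beyond {i} {c} h = bound , λ g → not-two-cliques h g (subst (_≼ succ (up i)) (≡.sym (up-succ i)) ≼-refl)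
    where
    bound : succ c ≼ up i
    bound with ≼-cmp (up i) c
    ... | inj₂ p = p
    ... | inj₁ p = ⊥-elim (not-two-cliques (⇒-sub ≼-refl (succ-≼-up i) p h) ⇒-refl
                     (subst (_≼ succ (succ (up i))) (≡.sym (up-succ i)) (≼-succ _)))

  -- The witness is the first position past the reach of `succ i`. Since `i` reaches no further,
  -- neither reaches it, and by `beyond` it reaches neither of their next lifts.
  common-far : ∀ i → ∃ λ v → ¬ Near (vtx i) v × ¬ Near (vtx (succ i)) v
  common-far i with last-⇒ (succ i)
  ... | c , h , n with beyond h
  ... | p≼ , n′ = vtx (succ c)
      , far i≼p p≼ (λ g → n (⇒-sub (≼-succ i) k≼p ≼-refl g)) n′
      , far k≼p (p≼ ∙ up-mono (≼-succ i)) n (λ g → n′ (⇒-sub ≼-refl p≼ (up-mono (≼-succ i)) g))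
    where
    k≼p = ⇒-≼ h ∙ ≼-succ c
    i≼p = ≼-succ i ∙ k≼p

  vtx-succ-≢ : ∀ i → vtx i ≢ vtx (succ i)
  vtx-succ-≢ i eq with ≼-cmp (up i) (succ i)
  ... | inj₁ p = not-two-cliques {i} ⇒-refl ⇒-refl (p ∙ ≼-succ _)
  ... | inj₂ p = succ-⋠ (subst (succ i ≼_) (≡.sym (lift-unique (≼-succ i) p eq)) ≼-refl)

  -- An arc that comes from the left and reaches `succ i` passes over `i` or starts there, so a
  -- neighbour gained by moving from `i` to `succ i` lies to the right.
  gain-right : ∀ {i v} → Near (vtx (succ i)) v → ¬ Near (vtx i) v →
    ∃ λ y → succ i ⇒ y × ¬ i ⇒ y
  gain-right {i} {v} h n with lift i v
  ... | y , i≼y , y≼ , refl with ≼-cmp y i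
  ... | inj₁ y≼i = ⊥-elim (n (inj₁ (cong vtx (≼-antisym i≼y y≼i))))
  ... | inj₂ k≼y with near-⇒ k≼y ((≼-succ y ∙ y≼) ∙ up-mono (≼-succ i)) h
  ... | inj₁ r = y , r , λ g → n (⇒-near g)
  ... | inj₂ r = ⊥-elim (n (near-sym (subst (Near (vtx y)) (vtx-up i)
                   (⇒-near (⇒-sub ≼-refl (≼-succ y ∙ y≼) (up-mono (≼-succ i)) r)))))

  gain-left : ∀ {i v} → Near (vtx i) v → ¬ Near (vtx (succ i)) v →
    ∃ λ y → y ⇒ i × ¬ y ⇒ succ i
  gain-left {i} {v} h n with lift (succ (dn i)) v
  ... | y , p , q , refl with near-⇒ y≼i (≼-succ i ∙ k≼) (near-sym h)
    where
    y≼i : y ≼ i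
    y≼i = succ-cancel (subst (succ y ≼_) (trans (up-succ _) (cong succ (up-dn i))) q)
    k≼ : succ i ≼ up y
    k≼ = subst (_≼ up y) (trans (up-succ _) (cong succ (up-dn i))) (up-mono p)
  ... | inj₁ r = y , r , λ g → n (near-sym (⇒-near g))
  ... | inj₂ r = ⊥-elim (n (subst (Near (vtx (succ i))) (vtx-up y)
                   (⇒-near (⇒-sub (≼-succ i) k≼ ≼-refl r))))
    where
    k≼ : succ i ≼ up y
    k≼ = subst (_≼ up y) (trans (up-succ _) (cong succ (up-dn i))) (up-mono p)

  -- The stretch of arc joining `succ e` to another position contains one of the two positions next
  -- to `succ e`.
  near-between : ∀ {e v} → Near (vtx (succ e)) v →
    v ≡ vtx (succ e) ⊎ Near (vtx e) v ⊎ Near (vtx (succ (succ e))) v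
  near-between {e} {v} h with lift (succ e) v
  ... | y , d≼y , y≼ , refl with ≼-cmp y (succ e)
  ... | inj₁ y≼d = inj₁ (cong vtx (≼-antisym y≼d d≼y))
  ... | inj₂ f≼y with near-⇒ d≼y (≼-succ y ∙ y≼) h
  ... | inj₁ r = inj₂ (inj₂ (⇒-near (⇒-sub (≼-succ _) f≼y ≼-refl r)))
  ... | inj₂ r = inj₂ (inj₁ (near-sym (subst (Near (vtx y)) (vtx-up e)
          (⇒-near (⇒-sub ≼-refl y≼e (up-mono (≼-succ e)) r)))))
    where
    y≼e : y ≼ up e
    y≼e = succ-cancel (subst (succ y ≼_) (up-succ e) y≼)

  -- An edge leaving the block [succ e , c] would pass over one of the gaps at its two ends.
  confined : ∀ {e c x u v} → ¬ e ⇒ succ e → ¬ c ⇒ succ c → succ e ≼ x → x ≼ c → vtx x ≡ u →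
    Walk G u v → ∃ λ y → succ e ≼ y × y ≼ c × vtx y ≡ v
  confined ne nc ex xc eq here = _ , ex , xc , eq
  confined {e} {c} {x} ne nc ex xc refl (step {v = w} a walk) with lift x w
  ... | y , x≼y , y≼ , refl with near-⇒ x≼y (≼-succ y ∙ y≼) (inj₂ a)
  ... | inj₁ r = confined ne nc (ex ∙ x≼y) y≼c refl walk
    where
    y≼c : y ≼ c
    y≼c with ≼-cmp y c
    ... | inj₁ p = p
    ... | inj₂ p = contradiction (⇒-sub xc (≼-succ c) p r) nc
  ... | inj₂ r = confined ne nc e≼z (⇒-≼ r′ ∙ xc) (vtx-dn y) walk
    where
    r′ : dn y ⇒ x
    r′ = subst (dn y ⇒_) (dn-up x) (⇒-dn r)
    e≼z : succ e ≼ dn y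
    e≼z with ≼-cmp (dn y) e
    ... | inj₁ p = contradiction (⇒-sub p (≼-succ e) ex r′) ne
    ... | inj₂ p = p

  -- The positions below satisfy e < a ≤ i < k < f ≤ c < p < q: N[k] is [a , c], the
  -- non-neighbours of k form [p , q], and N[i] also starts at a but ends before c.
  module Nested (i : P) (i⇒k : i ⇒ succ i) (i⊆k : ∀ {x} → Near (vtx i) x → Near (vtx (succ i)) x)
                (kept : Kept (vtx (succ i))) where

    k f c e a p q : P
    k = succ i
    f = succ k
    c = proj₁ (last-⇒ k)
    e = proj₁ (first-⇒ i)
    a = succ e
    p = succ c
    q = up e

    k⇒c : k ⇒ c
    k⇒c = proj₁ (proj₂ (last-⇒ k))
    k⇏p : ¬ k ⇒ p
    k⇏p = proj₂ (proj₂ (last-⇒ k))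
    a⇒i : a ⇒ i
    a⇒i = proj₁ (proj₂ (first-⇒ i))
    e⇏i : ¬ e ⇒ i
    e⇏i = proj₂ (proj₂ (first-⇒ i))

    k≼c : k ≼ c
    k≼c = ⇒-≼ k⇒c
    k≼p : k ≼ p
    k≼p = k≼c ∙ ≼-succ c
    i≼c : i ≼ c
    i≼c = ≼-succ i ∙ k≼c
    a≼i : a ≼ i
    a≼i = ⇒-≼ a⇒i
    a≼k : a ≼ k
    a≼k = a≼i ∙ ≼-succ i
    e≼i : e ≼ i
    e≼i = ≼-succ e ∙ a≼i
    ui≼uk : up i ≼ up k
    ui≼uk = up-mono (≼-succ i)
    ua : up a ≡ succ q
    ua = up-succ e

    -- As `i` and `k` are not twins, N[k] has a vertex outside N[i]; by the inclusion it is gained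
    -- on the right, hence lies at or before `c`.
    i⇏c : ¬ i ⇒ c
    i⇏c i⇒c with separated tf (vtx-succ-≢ i)
    ... | inj₁ (x , h , n) = n (i⊆k h)
    ... | inj₂ (x , h , n) with gain-right h n
    ... | y , k⇒y , i⇏y with ≼-cmp y c
    ... | inj₁ y≼c = i⇏y (⇒-sub ≼-refl (≼-succ i ∙ ⇒-≼ k⇒y) y≼c i⇒c)
    ... | inj₂ p≼y = k⇏p (⇒-sub ≼-refl k≼p p≼y k⇒y)

    p≼ui : p ≼ up i
    p≼ui = proj₁ (beyond k⇒c)
    p⇏ui : ¬ p ⇒ up i
    p⇏ui = proj₂ (beyond k⇒c)
    c⇏ui : ¬ c ⇒ up i
    c⇏ui h = p⇏ui (⇒-sub (≼-succ c) p≼ui ≼-refl h)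
    i⇏≽c : ∀ {x} → c ≼ x → ¬ i ⇒ x
    i⇏≽c c≼x h = i⇏c (⇒-sub ≼-refl i≼c c≼x h)

    k≼q : k ≼ q
    k≼q with ≼-cmp k q
    ... | inj₁ h = h
    ... | inj₂ h = ⊥-elim (not-two-cliques a⇒i ⇒-refl (subst (_≼ succ k) (≡.sym ua) (h ∙ ≼-succ k)))
    -- Otherwise [a , i] and [k , q] are cliques covering a full turn.
    k⇏q : ¬ k ⇒ q
    k⇏q h = not-two-cliques a⇒i h (subst (_≼ succ q) (≡.sym ua) ≼-refl)
    q≼ua : q ≼ up a
    q≼ua = up-mono (≼-succ e)
    k⇏ua : ¬ k ⇒ up a
    k⇏ua h = k⇏q (⇒-sub ≼-refl k≼q q≼ua h)
    -- The inclusion N[i] ⊆ N[k] makes `a` a neighbour of `k`, and `k⇏ua` rules out that `k` reaches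
    -- it around the other side.
    a⇒k : a ⇒ k
    a⇒k with near-⇒ a≼k (k≼q ∙ q≼ua) (near-sym (i⊆k (near-sym (⇒-near a⇒i))))
    ... | inj₁ h = h
    ... | inj₂ h = ⊥-elim (k⇏ua h)
    p≼q : p ≼ q
    p≼q with ≼-cmp q c
    ... | inj₁ h = ⊥-elim (k⇏q (⇒-sub ≼-refl k≼q h k⇒c))
    ... | inj₂ h = h
    q≼ui : q ≼ up i
    q≼ui = up-mono e≼i
    q≼uk : q ≼ up k
    q≼uk = q≼ui ∙ ui≼uk
    q⇏ui : ¬ q ⇒ up i
    q⇏ui h = e⇏i (⇒-up⁻ h)
    q⇏uk : ¬ q ⇒ up k
    q⇏uk h = q⇏ui (⇒-sub ≼-refl q≼ui ui≼uk h)

    far-k : ∀ {x} → p ≼ x → x ≼ q → ¬ Near (vtx k) (vtx x)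
    far-k px xq = far (k≼p ∙ px) (xq ∙ q≼uk) (λ h → k⇏p (⇒-sub ≼-refl k≼p px h))
      (λ h → q⇏uk (⇒-sub xq q≼uk ≼-refl h))
    far-i : ∀ {x} → c ≼ x → x ≼ q → ¬ x ⇒ up i → ¬ Near (vtx i) (vtx x)
    far-i cx xq n = far (i≼c ∙ cx) (xq ∙ q≼ui) (i⇏≽c cx) n
    far-i-p : ¬ Near (vtx i) (vtx p)
    far-i-p = far-i (≼-succ c) p≼q p⇏ui
    far-i-q : ¬ Near (vtx i) (vtx q)
    far-i-q = far-i (≼-succ c ∙ p≼q) ≼-refl q⇏ui
    far-k-p : ¬ Near (vtx k) (vtx p)
    far-k-p = far-k ≼-refl p≼q
    far-k-q : ¬ Near (vtx k) (vtx q)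
    far-k-q = far-k p≼q ≼-refl
    near-i-k : Near (vtx i) (vtx k)
    near-i-k = ⇒-near i⇒k

    -- Since N[k] is kept, `k` has a second non-neighbour besides `p`, and every non-neighbour has
    -- its lift in [p , q].
    p′≼q : succ p ≼ q
    p′≼q with ≼-cmp q p
    ... | inj₂ h = h
    ... | inj₁ q≼p with kept⇒two-far kept far-k-p
    ... | v , v≢p , n with lift k v
    ... | x , k≼x , x≼ , refl = ⊥-elim (v≢p (cong vtx (≼-antisym (x≼q ∙ q≼p) p≼x)))
      where
      p≼x : p ≼ x
      p≼x with ≼-cmp x c
      ... | inj₁ h = ⊥-elim (n (⇒-near (⇒-sub ≼-refl k≼x h k⇒c)))
      ... | inj₂ h = h
      x≼q : x ≼ q
      x≼q with ≼-cmp x q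
      ... | inj₁ h = h
      ... | inj₂ h = ⊥-elim (n (near-sym (subst (Near (vtx x)) (vtx-up k)
        (⇒-near (⇒-sub (subst (_≼ x) (≡.sym ua) h) (≼-succ x ∙ x≼) ≼-refl (⇒-up a⇒k))))))

    -- A detour N[i], N[w], N[k]. Because N[i] ⊆ N[k], the same four witnesses serve both overlaps,
    -- up to exchanging `k` for itself as common vertex.
    via : ∀ w → Near (vtx w) (vtx k) →
      (∃ λ v → Near (vtx w) v × ¬ Near (vtx i) v × ¬ Near (vtx k) v) →
      (∃ λ v → Near (vtx i) v × Near (vtx k) v × ¬ Near (vtx w) v) →
      (∃ λ v → ¬ Near (vtx i) v × ¬ Near (vtx k) v × ¬ Near (vtx w) v) →
      Path (vtx i) (vtx k)
    via w wk (x , xw , xi , xk) (y , yi , yk , yw) (z , zi , zk , zw) =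
      ((_ , near-i-k , wk) , (y , yi , yw) , (x , xw , xi) , (z , zi , zw)) ◅
      (((_ , wk , near-refl) , (x , xw , xk) , (y , yk , yw) , (z , zw , zk)) ◅ here)

    -- The right end `c` of N[k] sees `p` but neither `i` nor `q`.
    via-c : ¬ p ⇒ q → c ⇒ p → Path (vtx i) (vtx k)
    via-c p⇏q c⇒p = via c (near-sym (⇒-near k⇒c))
      (vtx p , ⇒-near c⇒p , far-i-p , far-k-p)
      (vtx i , near-refl , near-sym near-i-k , λ h → far i≼c (≼-succ c ∙ p≼ui) i⇏c c⇏ui (near-sym h))
      (vtx q , far-i-q , far-k-q , far (≼-succ c ∙ p≼q) (q≼uk ∙ up-mono k≼c)
        (λ h → p⇏q (⇒-sub (≼-succ c) p≼q ≼-refl h))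
        (λ h → q⇏uk (⇒-sub ≼-refl q≼uk (up-mono k≼c) h)))

    e⇏≽i : ∀ {x} → i ≼ x → ¬ e ⇒ x
    e⇏≽i ix h = e⇏i (⇒-sub ≼-refl e≼i ix h)

    -- Besides the gap after `c`, a second gap before `a` would confine all walks from `k` to
    -- [a , c], which contains no lift of the vertex of `p`.
    connected-e : ¬ c ⇒ p → e ⇒ a
    connected-e c⇏p with e ⇒? a
    ... | yes h = h
    ... | no e⇏a with confined e⇏a c⇏p a≼k k≼c refl (conn (vtx k) (vtx p))
    ... | y , a≼y , y≼c , eq = ⊥-elim (succ-⋠ (subst (_≼ c)
      (lift-unique (y≼c ∙ ≼-succ c) (succ-mono p≼q ∙ subst (_≼ up y) ua (up-mono a≼y)) eq) y≼c))

    -- The detour through N[e] shares `a` with both ends; `k` is outside N[e], so `via` does not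
    -- apply. All three sets miss `p`.
    via-e : ¬ p ⇒ q → ¬ c ⇒ p → Path (vtx i) (vtx k)
    via-e p⇏q c⇏p =
      ((vtx a , near-sym (⇒-near a⇒i) , ⇒-near e⇒a) , (vtx k , near-i-k , far-e-k)
        , (vtx e , near-refl , subst (λ v → ¬ Near (vtx i) v) (vtx-up e) far-i-q)
        , (vtx p , far-i-p , far-e-p)) ◅
      (((vtx a , ⇒-near e⇒a , near-sym (⇒-near a⇒k))
        , (vtx e , near-refl , subst (λ v → ¬ Near (vtx k) v) (vtx-up e) far-k-q)
        , (vtx k , near-refl , far-e-k) , (vtx p , far-e-p , far-k-p)) ◅ here)
      where
      e⇒a = connected-e c⇏p
      far-e-k : ¬ Near (vtx e) (vtx k)
      far-e-k = far (≼-succ e ∙ a≼k) k≼q (e⇏≽i (≼-succ i)) k⇏q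
      far-e-p : ¬ Near (vtx e) (vtx p)
      far-e-p = far (e≼i ∙ ≼-succ i ∙ k≼p) p≼q (e⇏≽i (≼-succ i ∙ k≼p)) p⇏q

    f≼c : f ≼ c
    f≼c with ≼-cmp c k
    ... | inj₁ h = ⊥-elim (i⇏≽c h i⇒k)
    ... | inj₂ h = h
    k⇒f : k ⇒ f
    k⇒f = ⇒-sub ≼-refl (≼-succ k) f≼c k⇒c
    f≼p : f ≼ p
    f≼p = f≼c ∙ ≼-succ c

    -- The first position `w` not reached by `a` lies in [f , c]. It sees `p` because `f` does, and
    -- misses `q` because [a , g] and [w , q] would be cliques covering a full turn.
    via-past-a : f ⇒ p → Path (vtx i) (vtx k)
    via-past-a f⇒p with last-⇒ a
    ... | g , a⇒g , a⇏w = via w (near-sym (⇒-near (⇒-sub ≼-refl k≼w w≼c k⇒c)))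
        (vtx p , ⇒-near (⇒-sub (succ-mono k≼g) (w≼c ∙ ≼-succ c) ≼-refl f⇒p) , far-i-p , far-k-p)
        (vtx a , near-sym (⇒-near a⇒i) , near-sym (⇒-near a⇒k)
          , λ h → far (a≼k ∙ k≼w) (w≼c ∙ ≼-succ c ∙ p≼q ∙ q≼ua) a⇏w w⇏ua (near-sym h))
        (vtx q , far-i-q , far-k-q , far w≼q (q≼uk ∙ up-mono k≼w) w⇏q
          (λ h → q⇏uk (⇒-sub ≼-refl q≼uk (up-mono k≼w) h)))
      where
      w = succ g
      k≼g : k ≼ g
      k≼g with ≼-cmp k g
      ... | inj₁ h = h
      ... | inj₂ h = ⊥-elim (a⇏w (⇒-sub ≼-refl (⇒-≼ a⇒g ∙ ≼-succ g) h a⇒k))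
      k≼w = k≼g ∙ ≼-succ g
      w≼c : w ≼ c
      w≼c with ≼-cmp c g
      ... | inj₁ h = ⊥-elim (i⇏≽c h (⇒-sub a≼i (≼-succ i ∙ k≼g) ≼-refl a⇒g))
      ... | inj₂ h = h
      w≼q = w≼c ∙ ≼-succ c ∙ p≼q
      w⇏q : ¬ w ⇒ q
      w⇏q h = not-two-cliques a⇒g h (subst (_≼ succ q) (≡.sym ua) ≼-refl)
      w⇏ua : ¬ w ⇒ up a
      w⇏ua h = w⇏q (⇒-sub ≼-refl w≼q q≼ua h)

    -- The remaining case: the non-neighbours of `k` form a clique, and `f` reaches no further than
    -- `k` does.
    module Dense (p⇒q : p ⇒ q) (f⇏p : ¬ f ⇒ p) where

      p⇒p′ : p ⇒ succ p
      p⇒p′ = ⇒-sub ≼-refl (≼-succ p) p′≼q p⇒q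

      -- Otherwise `k` and `f` are twins: `f` gains nothing on the right because `f⇏p`, and loses
      -- nothing on the left because N[k] starts at `a`.
      a⇏f : ¬ a ⇒ f
      a⇏f a⇒f with separated tf (vtx-succ-≢ k)
      ... | inj₂ (v , h , n) with gain-right h n
      ... | y , f⇒y , k⇏y with ≼-cmp y c
      ... | inj₁ y≼c = k⇏y (⇒-sub ≼-refl (≼-succ k ∙ ⇒-≼ f⇒y) y≼c k⇒c)
      ... | inj₂ p≼y = f⇏p (⇒-sub ≼-refl f≼p p≼y f⇒y)
      a⇏f a⇒f | inj₁ (v , h , n) with gain-left h n
      ... | y , y⇒k , y⇏f with ≼-cmp y e
      ... | inj₁ y≼e = e⇏≽i (≼-succ i) (⇒-sub y≼e (≼-succ e ∙ a≼k) ≼-refl y⇒k)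
      ... | inj₂ a≼y = y⇏f (⇒-sub a≼y (⇒-≼ y⇒k ∙ ≼-succ k) ≼-refl a⇒f)

      -- Such a `w` lies in [f , c]: `p` itself reaches `succ p`, and `f` does not reach `p`. It
      -- sees `p` and `k` but neither `a` nor `q`.
      via-left : ∀ w → w ⇒ p → ¬ w ⇒ succ p → Path (vtx i) (vtx k)
      via-left w w⇒p w⇏p′ = via w (near-sym (⇒-near (⇒-sub ≼-refl k≼w w≼c k⇒c)))
          (vtx p , ⇒-near w⇒p , far-i-p , far-k-p)
          (vtx a , near-sym (⇒-near a⇒i) , near-sym (⇒-near a⇒k)
            , λ h → far (a≼k ∙ k≼w) (w≼q ∙ q≼ua) (λ g → a⇏f (⇒-sub ≼-refl (a≼k ∙ ≼-succ k) f≼w g))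
                (λ g → w⇏p′ (⇒-sub ≼-refl w≼p′ (p′≼q ∙ q≼ua) g)) (near-sym h))
          (vtx q , far-i-q , far-k-q , far w≼q (q≼uk ∙ up-mono k≼w) (λ g → w⇏p′ (⇒-sub ≼-refl w≼p′ p′≼q g))
            (λ h → q⇏uk (⇒-sub ≼-refl q≼uk (up-mono k≼w) h)))
        where
        w≼c : w ≼ c
        w≼c with ≼-cmp w c
        ... | inj₁ h = h
        ... | inj₂ h = ⊥-elim (w⇏p′ (⇒-sub h (⇒-≼ w⇒p ∙ ≼-succ p) ≼-refl p⇒p′))
        f≼w : f ≼ w
        f≼w with ≼-cmp f w
        ... | inj₁ h = h
        ... | inj₂ h = ⊥-elim (f⇏p (⇒-sub (≼-succ w ∙ h) f≼p ≼-refl w⇒p))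
        k≼w = ≼-succ k ∙ f≼w
        w≼q = w≼c ∙ ≼-succ c ∙ p≼q
        w≼p′ = w≼c ∙ ≼-succ c ∙ ≼-succ p

      -- The route is N[i], N[f], N[dn w], N[k], all missing `p`. The position `dn w` lies in
      -- [a , i] and sees `k` and `succ p` but not `c`, whereas `f` sees `c` but neither `a` nor
      -- `succ p`.
      via-right : ∀ w → succ p ⇒ w → ¬ p ⇒ w → Path (vtx i) (vtx k)
      via-right w p′⇒w p⇏w =
          ((vtx k , near-i-k , near-sym (⇒-near k⇒f)) , (vtx a , near-sym (⇒-near a⇒i) , far-f-a)
            , (vtx c , near-f-c , far-i ≼-refl (≼-succ c ∙ p≼q) c⇏ui) , (vtx p , far-i-p , far-f-p ≼-refl p≼q)) ◅
          (((vtx k , near-sym (⇒-near k⇒f) , near-w-k) , (vtx c , near-f-c , far-w-c)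
            , (vtx (succ p) , near-w-p′ , far-f-p (≼-succ p) p′≼q) , (vtx p , far-f-p ≼-refl p≼q , far-w-p)) ◅
          (((vtx k , near-w-k , near-refl) , (vtx (succ p) , near-w-p′ , far-k (≼-succ p) p′≼q)
            , (vtx c , ⇒-near k⇒c , far-w-c) , (vtx p , far-w-p , far-k-p)) ◅ here))
        where
        w₀ = dn w
        uw₀ : up w₀ ≡ w
        uw₀ = up-dn w
        a≼w₀ : a ≼ w₀
        a≼w₀ with ≼-cmp w q
        ... | inj₁ h = ⊥-elim (p⇏w (⇒-sub ≼-refl (≼-succ p ∙ ⇒-≼ p′⇒w) h p⇒q))
        ... | inj₂ h = subst (_≼ w₀) (dn-up a) (dn-mono (subst (_≼ w) (≡.sym ua) h))
        p′⇏uk : ¬ succ p ⇒ up k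
        p′⇏uk h = q⇏uk (⇒-sub p′≼q q≼uk ≼-refl h)
        w₀≼i : w₀ ≼ i
        w₀≼i with ≼-cmp w₀ i
        ... | inj₁ h = h
        ... | inj₂ h = ⊥-elim (p′⇏uk (⇒-sub ≼-refl (p′≼q ∙ q≼uk) (subst (up k ≼_) uw₀ (up-mono h)) p′⇒w))
        near-w-k : Near (vtx w₀) (vtx k)
        near-w-k = ⇒-near (⇒-sub a≼w₀ (w₀≼i ∙ ≼-succ i) ≼-refl a⇒k)
        near-w-p′ : Near (vtx w₀) (vtx (succ p))
        near-w-p′ = near-sym (subst (Near _) (≡.sym (vtx-dn w)) (⇒-near p′⇒w))
        w₀⇏≽c : ∀ {x} → c ≼ x → ¬ w₀ ⇒ x
        w₀⇏≽c cx h = i⇏≽c cx (⇒-sub w₀≼i (i≼c ∙ cx) ≼-refl h)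
        p≼uw : p ≼ up w₀
        p≼uw = p≼q ∙ q≼ua ∙ up-mono a≼w₀
        p⇏uw : ¬ p ⇒ up w₀
        p⇏uw h = p⇏w (subst (p ⇒_) uw₀ h)
        far-w-p : ¬ Near (vtx w₀) (vtx p)
        far-w-p = far (w₀≼i ∙ i≼c ∙ ≼-succ c) p≼uw (w₀⇏≽c (≼-succ c)) p⇏uw
        far-w-c : ¬ Near (vtx w₀) (vtx c)
        far-w-c = far (w₀≼i ∙ i≼c) (≼-succ c ∙ p≼uw) (w₀⇏≽c ≼-refl)
          (λ h → p⇏uw (⇒-sub (≼-succ c) p≼uw ≼-refl h))
        near-f-c : Near (vtx f) (vtx c)
        near-f-c = ⇒-near (⇒-sub (≼-succ k) f≼c ≼-refl k⇒c)
        far-f-a : ¬ Near (vtx f) (vtx a)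
        far-f-a h = far (a≼k ∙ ≼-succ k) (f≼p ∙ p≼q ∙ q≼ua) a⇏f
          (λ g → not-two-cliques a⇒k g (≼-succ _)) (near-sym h)
        far-f-p : ∀ {x} → p ≼ x → x ≼ q → ¬ Near (vtx f) (vtx x)
        far-f-p px xq = far (f≼p ∙ px) (xq ∙ q≼uk ∙ up-mono (≼-succ k))
          (λ h → f⇏p (⇒-sub ≼-refl f≼p px h))
          (λ h → q⇏uk (⇒-sub xq q≼uk (up-mono (≼-succ k)) h))

      dense-path : Path (vtx i) (vtx k)
      dense-path with separated tf (vtx-succ-≢ p)
      -- Twin-freeness of `p` and `succ p`, both non-neighbours of `k`, provides the detour on one
      -- side or the other.
      ... | inj₁ (v , h , n) with gain-left h n
      ... | w , w⇒p , w⇏p′ = via-left w w⇒p w⇏p′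
      dense-path | inj₂ (v , h , n) with gain-right h n
      ... | w , p′⇒w , p⇏w = via-right w p′⇒w p⇏w

    nested-path : Path (vtx i) (vtx k)
    nested-path with p ⇒? q | c ⇒? p | f ⇒? p
    ... | no p⇏q | yes c⇒p | _ = via-c p⇏q c⇒p
    ... | no p⇏q | no c⇏p | _ = via-e p⇏q c⇏p
    ... | yes p⇒q | _ | yes f⇒p = via-past-a f⇒p
    ... | yes p⇒q | _ | no f⇏p = Dense.dense-path p⇒q f⇏p

-- Bypassing removed hyperedges, and the two conclusions.

module Connectivity {n : ℕ} (G : Graph n) (tf : TwinFreeGraph G) (conn : Connected G)
                    (ncb : ¬ ComplementBipartite G) (M : RoundModel G) where
  open Neighbourhoods G
  open RoundModel M
  open Overlaps G tf conn ncb M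

  module Mirrored = Overlaps G tf conn ncb (mirror M)

  kept? : ∀ v → Dec (Kept v)
  kept? v = ¬? (∣ N[ G ] v ∣ ℕ.≟ n ∸ 1)

  -- Incomparable neighbourhoods cross, with `common-far` outside both. A nested pair is treated by
  -- `nested-path`, in the mirrored model when N[succ i] is the smaller one.
  consecutive-path : ∀ i → i ⇒ succ i → Kept (vtx i) → Kept (vtx (succ i)) → Path (vtx i) (vtx (succ i))
  consecutive-path i i⇒k ki kk with near-⊆? (vtx i) (vtx (succ i)) | near-⊆? (vtx (succ i)) (vtx i)
  ... | inj₂ s | _ = Nested.nested-path i i⇒k s kk
  ... | inj₁ _ | inj₂ s = path-reverse (kept⇒H′ kk) (subst (λ z → Path (vtx (succ i)) (vtx z)) (prec-succ i)
        (Mirrored.Nested.nested-path (succ i) (subst (_⇒ succ i) (≡.sym (prec-succ i)) i⇒k)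
          (subst (λ z → ∀ {x} → Near (vtx (succ i)) x → Near (vtx z) x) (≡.sym (prec-succ i)) s)
          (subst (λ z → Kept (vtx z)) (≡.sym (prec-succ i)) ki)))
  ... | inj₁ l | inj₁ r =
        ((vtx i , near-refl , near-sym (⇒-near i⇒k)) , l , r , common-far i) ◅ here

  -- Data by which N[e] and N[succ (succ e)] replace the removed hyperedge N[succ e], both in paths
  -- and in separating vertices.
  record Bypass (e : P) : Set where
    field
      missed : Fin n
      far-e : ¬ Near (vtx e) missed
      far-f : ¬ Near (vtx (succ (succ e))) missed
      only : ∀ {v} → ¬ Near (vtx (succ e)) v → v ≡ missed
      cover : ∀ {v} → Near (vtx (succ e)) v → Near (vtx e) v ⊎ Near (vtx (succ (succ e))) v
      crossing : Cross (vtx e) (vtx (succ (succ e)))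

  -- N[d] misses just one vertex, so the common non-neighbour of `e`, `d` and that of `d`, `f`
  -- coincide.
  bypass : ∀ e → ¬ Kept (vtx (succ e)) → Bypass e
  bypass e nk with common-far e | common-far (succ e)
  ... | x , xe , xd | x′ , x′d , x′f = record
    { missed = x ; far-e = xe ; far-f = xf ; only = only ; cover = cover
    ; crossing = (vtx d , near-sym de , near-sym df) , left , right , (x , xe , xf) }
    where
    d f : P
    d = succ e
    f = succ d
    only : ∀ {v} → ¬ Near (vtx d) v → v ≡ x
    only {v} vd with v ≟ x
    ... | yes eq = eq
    ... | no v≢x = contradiction (two-far⇒kept v≢x vd xd) nk
    near-d : ∀ {v} → v ≢ x → Near (vtx d) v
    near-d {v} v≢x = decidable-stable (near? (vtx d) v) (λ n → v≢x (only n))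
    xf : ¬ Near (vtx f) x
    xf = subst (λ v → ¬ Near (vtx f) v) (only x′d) x′f
    de : Near (vtx d) (vtx e)
    de = near-d (λ eq → xe (inj₁ eq))
    df : Near (vtx d) (vtx f)
    df = near-d (λ eq → xf (inj₁ eq))
    cover : ∀ {v} → Near (vtx d) v → Near (vtx e) v ⊎ Near (vtx f) v
    cover h with near-between h
    ... | inj₁ refl = inj₁ (near-sym de)
    ... | inj₂ s = s
    -- N[d] misses only x, which N[e] and N[f] miss too, so by twin-freeness neither
    -- contains N[d].
    left : ∃ λ v → Near (vtx e) v × ¬ Near (vtx f) v
    left with separated tf (vtx-succ-≢ d)
    ... | inj₂ (v , h , m) = contradiction h (subst (λ z → ¬ Near (vtx f) z) (≡.sym (only m)) xf)
    ... | inj₁ (v , h , m) with cover h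
    ... | inj₁ g = v , g , m
    ... | inj₂ g = contradiction g m
    right : ∃ λ v → Near (vtx f) v × ¬ Near (vtx e) v
    right with separated tf (vtx-succ-≢ e)
    ... | inj₁ (v , h , m) = contradiction h (subst (λ z → ¬ Near (vtx e) z) (≡.sym (only m)) xe)
    ... | inj₂ (v , h , m) with cover h
    ... | inj₁ g = contradiction g m
    ... | inj₂ g = v , g , m

  bypass-at : ∀ d → ¬ Kept (vtx d) → ∃ λ e → succ e ≡ d × Bypass e
  bypass-at d nk = prec d , succ-prec d
    , bypass (prec d) (subst (λ z → ¬ Kept (vtx z)) (≡.sym (succ-prec d)) nk)

  kept-pred : ∀ {e} → Bypass e → Kept (vtx e)
  kept-pred b = cross⇒kept (cross-sym (Bypass.crossing b))

  kept-succ : ∀ {e} → Bypass e → Kept (vtx (succ (succ e)))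
  kept-succ b = cross⇒kept (Bypass.crossing b)

  -- The next vertex stands in for one whose hyperedge is removed. It depends on the vertex and not
  -- on its lift, so paths along different edges fit together.
  rep : Fin n → Fin n
  rep v with kept? v
  ... | yes _ = v
  ... | no _ = nextV v

  rep-kept : ∀ {v} → Kept v → rep v ≡ v
  rep-kept {v} k with kept? v
  ... | yes _ = refl
  ... | no nk = contradiction k nk

  link-path : ∀ i → i ⇒ succ i → Path (rep (vtx i)) (rep (vtx (succ i)))
  link-path i h with kept? (vtx i) | kept? (vtx (succ i))
  ... | yes ki | yes kk = consecutive-path i h ki kk
  -- The representative of `succ i` is `succ (succ i)`, whose neighbourhood crosses that of `i`.
  ... | yes ki | no nk = subst (Path (vtx i)) (vtx-succ (succ i)) (Bypass.crossing (bypass i nk) ◅ here)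
  ... | no ni | yes kk = subst (λ v → Path (nextV (vtx i)) v) (≡.sym (vtx-succ i)) here
  ... | no ni | no nk with bypass-at i ni
  ... | e , refl , b = contradiction (kept-succ b) nk

  -- If `x` reaches `y`, each position on the way reaches the next, so the links can be chained.
  reach-path : ∀ {x y} → Reach succ x y → x ⇒ y → Path (rep (vtx x)) (rep (vtx y))
  reach-path here h = here
  reach-path {x} {y} (next r) h with ≼-cmp y x
  ... | inj₁ y≼x = subst (λ z → Path (rep (vtx x)) (rep (vtx z))) (≼-antisym (⇒-≼ h) y≼x) here
  ... | inj₂ x≺y = path-++ (link-path x (⇒-sub ≼-refl (≼-succ x) x≺y h))
                     (reach-path r (⇒-sub (≼-succ x) x≺y ≼-refl h))

  ⇒-path : ∀ {x y} → x ⇒ y → Path (rep (vtx x)) (rep (vtx y))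
  ⇒-path {x} {y} h = reach-path (reach (⇒-≼ h) (≼-succ y ∙ ⇒⇒≼-up h)) h

  rep-is-kept : ∀ x → Kept (rep (vtx x))
  rep-is-kept x with kept? (vtx x)
  ... | yes k = k
  ... | no nk with bypass-at x nk
  ... | e , refl , b = subst Kept (vtx-succ x) (kept-succ b)

  edge-path : ∀ x y → vtx x ≡ vtx y ⊎ Adj G (vtx x) (vtx y) → x ≼ y → y ≼ up x →
    Path (rep (vtx x)) (rep (vtx y))
  edge-path x y a p q with near-⇒ p q a
  ... | inj₁ h = ⇒-path h
  ... | inj₂ h = path-reverse (kept⇒H′ (rep-is-kept y))
                   (subst (λ v → Path (rep (vtx y)) (rep v)) (vtx-up x) (⇒-path h))

  walk-path : ∀ {u v} x → vtx x ≡ u → Walk G u v → Path (rep u) (rep v)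
  walk-path x eq here = here
  walk-path x refl (step {v = w} a walk) with lift x w
  ... | y , p , q , refl = path-++ (edge-path x y (inj₂ a) p (≼-succ y ∙ q)) (walk-path y refl walk)

  module _ (position : ∀ v → ∃ λ x → vtx x ≡ v) where

    kept-path : ∀ {u v} → Kept u → Kept v → Path u v
    kept-path {u} {v} ku kv with position u
    ... | x , eq = subst₂ Path (rep-kept ku) (rep-kept kv) (walk-path x eq (conn u v))

    -- If N[w] is removed, `v` is the only vertex it misses. Both bypassing neighbourhoods miss `v`,
    -- and one of them contains `u`.
    separating : ∀ {u v w} → Near w u → ¬ Near w v → ∃ λ z → Kept z × Near z u × ¬ Near z v
    separating {u} {v} {w} h m with kept? w
    ... | yes k = w , k , h , m
    ... | no nk with position w
    ... | x , refl with bypass-at x nk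
    ... | e , refl , b with Bypass.only b m | Bypass.cover b h
    ... | refl | inj₁ g = vtx e , kept-pred b , g , Bypass.far-e b
    ... | refl | inj₂ g = vtx (succ (succ e)) , kept-succ b , g , Bypass.far-f b

    twin-free : TwinFreeHyp (H′ G)
    twin-free u v u≢v with separated tf u≢v
    ... | inj₁ (w , h , m) with separating (near-sym h) (λ g → m (near-sym g))
    ... | z , k , zu , zv = N[ G ] z , kept⇒H′ k
        , λ eqv → zv (∈⇒near (Equivalence.to eqv (near⇒∈ zu)))
    twin-free u v u≢v | inj₂ (w , h , m) with separating (near-sym h) (λ g → m (near-sym g))
    ... | z , k , zv , zu = N[ G ] z , kept⇒H′ k
        , λ eqv → zu (∈⇒near (Equivalence.from eqv (near⇒∈ zv)))

    -- N[v] separates `v` from some non-neighbour; a kept hyperedge doing the same contains `v`.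
    covered : ∀ v → ∃ λ E → H′ G E × v ∈ E
    covered v with position v
    ... | x , refl with common-far x
    ... | y , m , _ with separating {w = vtx x} near-refl m
    ... | z , k , h , _ = N[ G ] z , kept⇒H′ k , near⇒∈ h

    overlap-connected : StrictlyOverlapConnected (H′ G)
    overlap-connected = covered , λ { _ _ (u , refl , ku) (v , refl , kv) → kept-path ku kv }

-- Finite minima and the ordered universal cover.

least : ∀ {m} (_≲_ : Fin m → Fin m → Set) → (∀ u v → u ≲ v ⊎ v ≲ u) → (∀ {u v w} → u ≲ v → v ≲ w → u ≲ w) →
  {Q : Fin m → Set} → (∀ v → Dec (Q v)) → (∀ v → ¬ Q v) ⊎ (∃ λ u → Q u × ∀ v → Q v → u ≲ v)
least {zero} _≲_ total tr Q? = inj₁ λ ()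
least {suc m} _≲_ total tr Q? with Q? zero
  | least (λ u v → suc u ≲ suc v) (λ u v → total (suc u) (suc v)) tr (λ v → Q? (suc v))
... | no n | inj₁ none = inj₁ λ { zero → n ; (suc v) → none v }
... | no n | inj₂ (u , q , l) = inj₂ (suc u , q , λ { zero q₀ → contradiction q₀ n ; (suc v) → l v })
... | yes q | inj₁ none =
  -- Reflexivity is extracted from totality.
  inj₂ (zero , q , λ { zero _ → reduce (total zero zero) ; (suc v) qv → contradiction qv (none v) })
... | yes q | inj₂ (u , qu , l) with total zero (suc u)
... | inj₁ p = inj₂ (zero , q , λ { zero _ → reduce (total zero zero) ; (suc v) qv → tr p (l v qv) })
... | inj₂ p = inj₂ (suc u , qu , λ { zero _ → p ; (suc v) qv → l v qv })

-- A point of the universal cover ℝ of the circle is its number of turns together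
-- with its position in [0,1); no arithmetic on ℚ is needed.
Point : Set
Point = ℤ × ℚ

infix 4 _⊑_
_⊑_ : Point → Point → Set
(k , x) ⊑ (l , y) = k ℤ.< l ⊎ (k ≡ l × x ℚ.≤ y)

k<1+k : ∀ {k} → k ℤ.< ℤ.suc k
k<1+k = ℤ.suc[i]≤j⇒i<j ℤ.≤-refl

<⇒1+≤ : ∀ {k l} → k ℤ.< l → ℤ.suc k ℤ.≤ l
<⇒1+≤ = ℤ.i<j⇒suc[i]≤j

<-squeeze : ∀ {k l} → k ℤ.< l → l ℤ.< ℤ.suc k → ⊥
<-squeeze p q = ℤ.<-irrefl refl (ℤ.<-≤-trans q (<⇒1+≤ p))

suc-mono-< : ∀ {k l} → k ℤ.< l → ℤ.suc k ℤ.< ℤ.suc l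
suc-mono-< p = ℤ.suc[i]≤j⇒i<j (ℤ.suc-mono (<⇒1+≤ p))

pred-mono-< : ∀ {k l} → k ℤ.< l → ℤ.pred k ℤ.< ℤ.pred l
pred-mono-< p = ℤ.i≤pred[j]⇒i<j (ℤ.pred-mono (ℤ.i<j⇒i≤pred[j] p))

⊑-refl : ∀ {p} → p ⊑ p
⊑-refl = inj₂ (refl , ℚ.≤-refl)

⊑-trans : ∀ {p q r} → p ⊑ q → q ⊑ r → p ⊑ r
⊑-trans (inj₁ a) (inj₁ b) = inj₁ (ℤ.<-trans a b)
⊑-trans (inj₁ a) (inj₂ (refl , _)) = inj₁ a
⊑-trans (inj₂ (refl , _)) (inj₁ b) = inj₁ b
⊑-trans (inj₂ (refl , a)) (inj₂ (refl , b)) = inj₂ (refl , ℚ.≤-trans a b)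

⊑-antisym : ∀ {p q} → p ⊑ q → q ⊑ p → p ≡ q
⊑-antisym (inj₁ a) (inj₁ b) = ⊥-elim (ℤ.<-asym a b)
⊑-antisym (inj₁ a) (inj₂ (refl , _)) = ⊥-elim (ℤ.<-irrefl refl a)
⊑-antisym (inj₂ (refl , _)) (inj₁ b) = ⊥-elim (ℤ.<-irrefl refl b)
⊑-antisym (inj₂ (refl , a)) (inj₂ (_ , b)) = cong (_ ,_) (ℚ.≤-antisym a b)

⊑-total : ∀ p q → p ⊑ q ⊎ q ⊑ p
⊑-total (k , x) (l , y) with ℤ.<-cmp k l
... | tri< a _ _ = inj₁ (inj₁ a)
... | tri> _ _ b = inj₂ (inj₁ b)
... | tri≈ _ refl _ with ℚ.≤-total x y
... | inj₁ h = inj₁ (inj₂ (refl , h))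
... | inj₂ h = inj₂ (inj₂ (refl , h))

_⊑?_ : ∀ p q → Dec (p ⊑ q)
(k , x) ⊑? (l , y) = (k ℤ.<? l) ⊎-dec ((k ℤ.≟ l) ×-dec (x ℚ.≤? y))

turn back : Point → Point
turn (k , x) = ℤ.suc k , x
back (k , x) = ℤ.pred k , x

turn-mono : ∀ {p q} → p ⊑ q → turn p ⊑ turn q
turn-mono (inj₁ a) = inj₁ (suc-mono-< a)
turn-mono (inj₂ (refl , a)) = inj₂ (refl , a)

back-mono : ∀ {p q} → p ⊑ q → back p ⊑ back q
back-mono (inj₁ a) = inj₁ (pred-mono-< a)
back-mono (inj₂ (refl , a)) = inj₂ (refl , a)

⊑-turns : ∀ {k l x} → k ℤ.≤ l → (k , x) ⊑ (l , x)
⊑-turns {k} {l} h with ℤ.<-cmp k l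
... | tri< a _ _ = inj₁ a
... | tri≈ _ refl _ = ⊑-refl
... | tri> _ _ b = ⊥-elim (ℤ.<-irrefl refl (ℤ.<-≤-trans b h))

-- The round model of a proper arc representation.

module ArcModel {n : ℕ} (G : Graph n) (A : Fin n → Arc)
  (intersect : (u v : Fin n) → u ≢ v → (Adj G u v ⇔ ArcsIntersect (A u) (A v)))
  (proper : (u v : Fin n) → u ≢ v → ¬ ArcSubset (A u) (A v)) where
  open Neighbourhoods G

  s t : Fin n → ℚ
  s u = start (A u)
  t u = end (A u)

  P : Set
  P = ℤ × Fin n

  -- An arc whose end precedes its start passes through 0, so its lift ends one turn later.
  wrap : ∀ {B : Set} → Dec B → ℤ → ℤ
  wrap (yes _) k = k
  wrap (no _) k = ℤ.suc k

  S E : P → Point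
  S (k , u) = k , s u
  E (k , u) = wrap (s u ℚ.≤? t u) k , t u

  up dn : P → P
  up (k , u) = ℤ.suc k , u
  dn (k , u) = ℤ.pred k , u

  E-up : ∀ p → E (up p) ≡ turn (E p)
  E-up (k , u) with s u ℚ.≤? t u
  ... | yes _ = refl
  ... | no _ = refl

  E-dn : ∀ p → E (dn p) ≡ back (E p)
  E-dn (k , u) with s u ℚ.≤? t u
  ... | yes _ = refl
  ... | no _ = cong (_, t u) (trans (ℤ.suc-pred k) (≡.sym (ℤ.pred-suc k)))

  S⊑E : ∀ p → S p ⊑ E p
  S⊑E (k , u) with s u ℚ.≤? t u
  ... | yes h = inj₂ (refl , h)
  ... | no _ = inj₁ k<1+k

  arc⇒span : ∀ {x} u → InArc x (A u) → ∀ k → ∃ λ m → S (k , u) ⊑ (m , x) × (m , x) ⊑ E (k , u)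
  arc⇒span u i k with s u ℚ.≤? t u
  arc⇒span u (inj₁ (_ , a , b)) k | yes _ = k , inj₂ (refl , a) , inj₂ (refl , b)
  arc⇒span u (inj₁ (h , _)) k | no n = contradiction h n
  arc⇒span u (inj₂ (h , _)) k | yes h′ = ⊥-elim (ℚ.<-irrefl refl (ℚ.<-≤-trans h h′))
  arc⇒span u (inj₂ (_ , inj₁ a)) k | no _ = k , inj₂ (refl , a) , inj₁ k<1+k
  arc⇒span u (inj₂ (_ , inj₂ b)) k | no _ = ℤ.suc k , inj₁ k<1+k , inj₂ (refl , b)

  span⇒arc : ∀ {x k u m} → S (k , u) ⊑ (m , x) → (m , x) ⊑ E (k , u) → InArc x (A u)
  span⇒arc {u = u} p q with s u ℚ.≤? t u
  span⇒arc (inj₁ a) (inj₁ b) | yes _ = ⊥-elim (ℤ.<-asym a b)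
  span⇒arc (inj₁ a) (inj₂ (refl , _)) | yes _ = ⊥-elim (ℤ.<-irrefl refl a)
  span⇒arc (inj₂ (refl , _)) (inj₁ b) | yes _ = ⊥-elim (ℤ.<-irrefl refl b)
  span⇒arc (inj₂ (_ , a)) (inj₂ (_ , b)) | yes h = inj₁ (h , a , b)
  span⇒arc (inj₂ (_ , a)) _ | no n = inj₂ (ℚ.≰⇒> n , inj₁ a)
  span⇒arc (inj₁ _) (inj₂ (_ , b)) | no n = inj₂ (ℚ.≰⇒> n , inj₂ b)
  span⇒arc (inj₁ a) (inj₁ b) | no _ = ⊥-elim (<-squeeze a b)

  span-subset : ∀ {k u l v} → S (l , v) ⊑ S (k , u) → E (k , u) ⊑ E (l , v) → ArcSubset (A u) (A v)
  span-subset {k} {u} {l} {v} p q x _ i with arc⇒span u i k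
  ... | m , a , b = span⇒arc {k = l} {u = v} (⊑-trans p a) (⊑-trans b q)

  -- Properness enters here: ends in the opposite order to the starts would nest one arc in the
  -- other. Lifts of the same arc differ by whole turns.
  E-mono : ∀ {p q} → S p ⊑ S q → E p ⊑ E q
  E-mono {k , u} {l , v} h with ⊑-total (E (k , u)) (E (l , v))
  ... | inj₁ g = g
  ... | inj₂ g with u ≟ v
  ... | no u≢v = contradiction (span-subset {l} {v} {k} {u} h g) (proper v u (λ eq → u≢v (≡.sym eq)))
  E-mono {k , u} {l , v} (inj₂ (refl , _)) | inj₂ g | yes refl = ⊑-refl
  E-mono {k , u} {l , v} (inj₁ a) | inj₂ g | yes refl with s u ℚ.≤? t u
  ... | yes _ = inj₁ a
  ... | no _ = inj₁ (suc-mono-< a)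

  -- Of two arcs with a common start one contains the other. Hence positions are ordered without
  -- ties.
  s-injective : ∀ {u v} → s u ≡ s v → u ≡ v
  s-injective {u} {v} eq with u ≟ v
  ... | yes u≡v = u≡v
  ... | no u≢v = contradiction
    (span-subset {0ℤ} {u} {0ℤ} {v} (inj₂ (refl , ℚ.≤-reflexive (≡.sym eq)))
      (E-mono {0ℤ , u} {0ℤ , v} (inj₂ (refl , ℚ.≤-reflexive eq))))
    (proper u v u≢v)

  infix 4 _≼_ _⇒_
  _≼_ _⇒_ : P → P → Set
  p ≼ q = S p ⊑ S q
  p ⇒ q = p ≼ q × S q ⊑ E p

  ≼-antisym : ∀ {p q} → p ≼ q → q ≼ p → p ≡ q
  ≼-antisym {k , u} {l , v} a b with ⊑-antisym a b
  ... | eq with cong proj₁ eq | s-injective {u} {v} (cong proj₂ eq)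
  ... | refl | refl = refl

  after : ∀ u → (∀ v → ¬ s u ℚ.< s v) ⊎ (∃ λ w → s u ℚ.< s w × ∀ v → s u ℚ.< s v → s w ℚ.≤ s v)
  after u = least (λ v w → s v ℚ.≤ s w) (λ v w → ℚ.≤-total (s v) (s w)) ℚ.≤-trans (λ v → s u ℚ.<? s v)

  before : ∀ u → (∀ v → ¬ s v ℚ.< s u) ⊎ (∃ λ w → s w ℚ.< s u × ∀ v → s v ℚ.< s u → s v ℚ.≤ s w)
  before u = least (λ v w → s w ℚ.≤ s v) (λ v w → ℚ.≤-total (s w) (s v)) (λ a b → ℚ.≤-trans b a)
    (λ v → s v ℚ.<? s u)

  lowest : Fin n → ∃ λ w → ∀ v → s w ℚ.≤ s v
  lowest u with least (λ v w → s v ℚ.≤ s w) (λ v w → ℚ.≤-total (s v) (s w)) ℚ.≤-trans (λ _ → yes tt)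
  ... | inj₁ none = ⊥-elim (none u tt)
  ... | inj₂ (w , _ , l) = w , λ v → l v tt

  highest : Fin n → ∃ λ w → ∀ v → s v ℚ.≤ s w
  highest u with least (λ v w → s w ℚ.≤ s v) (λ v w → ℚ.≤-total (s w) (s v)) (λ a b → ℚ.≤-trans b a) (λ _ → yes tt)
  ... | inj₁ none = ⊥-elim (none u tt)
  ... | inj₂ (w , _ , l) = w , λ v → l v tt

  nextV prevV : Fin n → Fin n
  nextV u with after u
  ... | inj₁ _ = proj₁ (lowest u)
  ... | inj₂ (w , _) = w
  prevV u with before u
  ... | inj₁ _ = proj₁ (highest u)
  ... | inj₂ (w , _) = w

  succ prec : P → P
  succ (k , u) with after u
  ... | inj₁ _ = ℤ.suc k , proj₁ (lowest u)
  ... | inj₂ (w , _) = k , w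
  prec (k , u) with before u
  ... | inj₁ _ = ℤ.pred k , proj₁ (highest u)
  ... | inj₂ (w , _) = k , w

  pred<k : ∀ {k} → ℤ.pred k ℤ.< k
  pred<k = ℤ.i≤pred[j]⇒i<j ℤ.≤-refl

  succ-⋠ : ∀ {p} → ¬ succ p ≼ p
  succ-⋠ {k , u} h with after u
  succ-⋠ {k , u} (inj₁ a) | inj₁ _ = ℤ.<-asym a k<1+k
  succ-⋠ {k , u} (inj₂ (eq , _)) | inj₁ _ = ℤ.<-irrefl (≡.sym eq) k<1+k
  succ-⋠ {k , u} (inj₁ a) | inj₂ _ = ℤ.<-irrefl refl a
  succ-⋠ {k , u} (inj₂ (_ , a)) | inj₂ (w , b , _) = ℚ.<-irrefl refl (ℚ.<-≤-trans b a)

  prec-⋡ : ∀ {p} → ¬ p ≼ prec p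
  prec-⋡ {k , u} h with before u
  prec-⋡ {k , u} (inj₁ a) | inj₁ _ = ℤ.<-asym a pred<k
  prec-⋡ {k , u} (inj₂ (eq , _)) | inj₁ _ = ℤ.<-irrefl (≡.sym eq) pred<k
  prec-⋡ {k , u} (inj₁ a) | inj₂ _ = ℤ.<-irrefl refl a
  prec-⋡ {k , u} (inj₂ (_ , a)) | inj₂ (w , b , _) = ℚ.<-irrefl refl (ℚ.≤-<-trans a b)

  -- With `succ-⋠` this characterises `succ`, so its monotonicity and inverse laws need no further
  -- case analysis.
  succ-least : ∀ p q → ¬ q ≼ p → succ p ≼ q
  succ-least (k , u) (l , v) n with ℤ.<-cmp l k
  ... | tri< a _ _ = contradiction (inj₁ a) n
  ... | tri≈ _ refl _ with after u
  ... | inj₁ none = ⊥-elim (none v (ℚ.≰⇒> λ h → n (inj₂ (refl , h))))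
  ... | inj₂ (w , _ , l′) = inj₂ (refl , l′ v (ℚ.≰⇒> λ h → n (inj₂ (refl , h))))
  succ-least (k , u) (l , v) n | tri> _ _ b with after u
  ... | inj₂ _ = inj₁ b
  ... | inj₁ _ with lowest u
  ... | w , low = ⊑-trans (inj₂ (refl , low v)) (⊑-turns (<⇒1+≤ b))

  prec-greatest : ∀ p q → ¬ p ≼ q → q ≼ prec p
  prec-greatest (k , u) (l , v) n with ℤ.<-cmp k l
  ... | tri< a _ _ = contradiction (inj₁ a) n
  ... | tri≈ _ refl _ with before u
  ... | inj₁ none = ⊥-elim (none v (ℚ.≰⇒> λ h → n (inj₂ (refl , h))))
  ... | inj₂ (w , _ , g) = inj₂ (refl , g v (ℚ.≰⇒> λ h → n (inj₂ (refl , h))))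
  prec-greatest (k , u) (l , v) n | tri> _ _ b with before u
  ... | inj₂ _ = inj₁ b
  ... | inj₁ _ with highest u
  ... | w , high = ⊑-trans (⊑-turns (ℤ.i<j⇒i≤pred[j] b)) (inj₂ (refl , high v))

  ≼-cmp : ∀ p q → p ≼ q ⊎ succ q ≼ p
  ≼-cmp p q with S p ⊑? S q
  ... | yes h = inj₁ h
  ... | no h = inj₂ (succ-least q p h)

  ≼-succ : ∀ p → p ≼ succ p
  ≼-succ p with ⊑-total (S p) (S (succ p))
  ... | inj₁ h = h
  ... | inj₂ h = contradiction h succ-⋠

  succ-prec : ∀ p → succ (prec p) ≡ p
  succ-prec p = ≼-antisym (succ-least (prec p) p prec-⋡)
    (decidable-stable (_ ⊑? _) λ h → succ-⋠ {prec p} (prec-greatest p (succ (prec p)) h))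

  prec-succ : ∀ p → prec (succ p) ≡ p
  prec-succ p = ≼-antisym (decidable-stable (_ ⊑? _) λ h → prec-⋡ {succ p} (succ-least p (prec (succ p)) h))
    (prec-greatest (succ p) p succ-⋠)

  up-⋠ : ∀ p → ¬ up p ≼ p
  up-⋠ p (inj₁ a) = ℤ.<-asym a k<1+k
  up-⋠ p (inj₂ (eq , _)) = ℤ.<-irrefl (≡.sym eq) k<1+k

  ⊏ : Fin n → Fin n → Set
  ⊏ u v = s u ℚ.< s v

  ⊏-isStrictPartialOrder : IsStrictPartialOrder _≡_ ⊏
  ⊏-isStrictPartialOrder = record
    { isEquivalence = ≡.isEquivalence
    ; irrefl = λ { refl → ℚ.<-irrefl refl }
    ; trans = ℚ.<-trans
    ; <-resp-≈ = (λ { refl h → h }) , (λ { refl h → h })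
    }

  noetherian : WellFounded (flip ⊏)
  noetherian = spo-noetherian ⊏-isStrictPartialOrder

  -- Recursion on the finitely many later starting points of the turn; the next one never skips `v`.
  reach-same : ∀ {u v} → Acc (flip ⊏) u → ∀ k → s u ℚ.≤ s v → Reach succ (k , u) (k , v)
  reach-same {u} {v} (acc rs) k h with u ≟ v
  ... | yes refl = here
  ... | no u≢v = next rest
    where
    u<v : s u ℚ.< s v
    u<v = ℚ.≰⇒> λ g → u≢v (s-injective (ℚ.≤-antisym h g))
    rest : Reach succ (succ (k , u)) (k , v)
    rest with after u
    ... | inj₁ none = contradiction u<v (none v)
    ... | inj₂ (w , a , l) = reach-same (rs a) k (l v u<v)

  reach-turn : ∀ {u} → Acc (flip ⊏) u → ∀ k v → Reach succ (k , u) (ℤ.suc k , v)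
  reach-turn {u} (acc rs) k v = next rest
    where
    rest : Reach succ (succ (k , u)) (ℤ.suc k , v)
    rest with after u
    ... | inj₁ _ = reach-same (noetherian _) (ℤ.suc k) (proj₂ (lowest u) v)
    ... | inj₂ (w , a , _) = reach-turn (rs a) k v

  reach : ∀ {p q} → p ≼ q → q ≼ up p → Reach succ p q
  reach {k , u} {l , v} (inj₂ (refl , h)) _ = reach-same (noetherian u) k h
  reach {k , u} {l , v} (inj₁ a) (inj₁ b) = ⊥-elim (<-squeeze a b)
  reach {k , u} {l , v} (inj₁ a) (inj₂ (refl , _)) = reach-turn (noetherian u) k v

  ⇒-near : ∀ {p q} → p ⇒ q → Near (proj₂ p) (proj₂ q)
  ⇒-near {k , u} {l , v} (p≼q , h) with u ≟ v
  ... | yes eq = inj₁ eq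
  ... | no u≢v = inj₂ (Equivalence.from (intersect u v u≢v)
    (s v , startC (A v) , span⇒arc {k = k} {u} p≼q h , span⇒arc {k = l} {v} ⊑-refl (S⊑E (l , v))))

  -- A common point `z` of the arcs is lifted to turn `m` in the span of `p` and to turn `m′` in
  -- that of `q`. If `m′` is at most `m`, the span of `p` extends past the start of `q`; otherwise
  -- that of `q` extends past the start of `up p`.
  near-⇒ : ∀ {p q} → p ≼ q → q ≼ up p → Near (proj₂ p) (proj₂ q) → p ⇒ q ⊎ q ⇒ up p
  near-⇒ {k , u} {l , v} a b h with u ≟ v
  near-⇒ {k , u} {l , v} (inj₂ (refl , a)) b h | yes refl = inj₁ (⊑-refl , S⊑E (k , u))
  near-⇒ {k , u} {l , v} (inj₁ a) (inj₁ b) h | yes refl = ⊥-elim (<-squeeze a b)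
  near-⇒ {k , u} {l , v} (inj₁ a) (inj₂ (refl , _)) h | yes refl = inj₂ (⊑-refl , S⊑E (l , u))
  near-⇒ {k , u} {l , v} a b (inj₁ eq) | no u≢v = contradiction eq u≢v
  near-⇒ {k , u} {l , v} a b (inj₂ h) | no u≢v with Equivalence.to (intersect u v u≢v) h
  ... | z , _ , zu , zv with arc⇒span u zu k | arc⇒span v zv l
  ... | m , a₁ , a₂ | m′ , b₁ , b₂ with m′ ℤ.≤? m
  ... | yes g = inj₁ (a , ⊑-trans b₁ (⊑-trans (⊑-turns g) a₂))
  ... | no g = inj₂ (b , ⊑-trans (turn-mono a₁) (⊑-trans (⊑-turns (<⇒1+≤ (ℤ.≰⇒> g))) b₂))

  lift : ∀ p v → ∃ λ q → p ≼ q × succ q ≼ up p × proj₂ q ≡ v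
  lift (k , u) v with s u ℚ.≤? s v
  ... | yes h = (k , v) , inj₂ (refl , h) , succ-least (k , v) (up (k , u))
        (λ { (inj₁ a) → ℤ.<-asym a k<1+k ; (inj₂ (eq , _)) → ℤ.<-irrefl (≡.sym eq) k<1+k }) , refl
  ... | no h = (ℤ.suc k , v) , inj₁ k<1+k , succ-least (ℤ.suc k , v) (up (k , u))
        (λ { (inj₁ a) → ℤ.<-irrefl refl a ; (inj₂ (_ , a)) → h a }) , refl

  lift-unique : ∀ {p q} → p ≼ q → succ q ≼ up p → proj₂ p ≡ proj₂ q → p ≡ q
  lift-unique {k , u} {l , v} (inj₁ a) b refl =
    contradiction (⊑-trans b (⊑-turns (<⇒1+≤ a))) (succ-⋠ {l , v})
  lift-unique {k , u} {l , v} (inj₂ (refl , _)) _ refl = refl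

  roundModel : RoundModel G
  roundModel = record
    { P = P ; _≼_ = _≼_ ; _⇒_ = _⇒_ ; vtx = proj₂
    ; succ = succ ; prec = prec ; up = up ; dn = dn ; nextV = nextV ; prevV = prevV
    ; vtx-succ = vtx-succ
    ; vtx-prec = vtx-prec
    ; vtx-up = λ _ → refl
    ; ≼-refl = ⊑-refl ; ≼-trans = ⊑-trans ; ≼-antisym = ≼-antisym
    ; ≼-cmp = ≼-cmp ; ≼-succ = ≼-succ
    ; succ-⋠ = λ {p} → succ-⋠ {p}
    ; succ-mono = λ {p} {q} h → succ-least p (succ q) (λ g → succ-⋠ {q} (⊑-trans g h))
    ; prec-mono = λ {p} {q} h → prec-greatest q (prec p) (λ g → prec-⋡ {p} (⊑-trans h g))
    ; succ-prec = succ-prec ; prec-succ = prec-succ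
    ; up-mono = turn-mono ; dn-mono = back-mono
    ; up-dn = λ { (k , u) → cong (_, u) (ℤ.suc-pred k) }
    ; dn-up = λ { (k , u) → cong (_, u) (ℤ.pred-suc k) }
    ; up-succ = up-succ
    ; succ-≼-up = λ p → succ-least p (up p) (up-⋠ p)
    ; reach = reach ; lift = lift ; lift-unique = lift-unique
    ; _⇒?_ = λ p q → (S p ⊑? S q) ×-dec (S q ⊑? E p)
    ; ⇒-refl = λ {p} → ⊑-refl , S⊑E p
    ; ⇒-≼ = proj₁
    -- By `E-mono` the arc starting later also ends no earlier, so it still covers the target.
    ; ⇒-sub = λ {p} {p′} a b c h → b , ⊑-trans c (⊑-trans (proj₂ h) (E-mono {p} {p′} a))
    ; ⇒-up = λ {p} {q} h → turn-mono (proj₁ h) , subst (turn (S q) ⊑_) (≡.sym (E-up p)) (turn-mono (proj₂ h))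
    ; ⇒-dn = λ {p} {q} h → back-mono (proj₁ h) , subst (back (S q) ⊑_) (≡.sym (E-dn p)) (back-mono (proj₂ h))
    ; ⇒-near = ⇒-near ; near-⇒ = near-⇒
    }
    where
    vtx-succ : ∀ p → proj₂ (succ p) ≡ nextV (proj₂ p)
    vtx-succ (k , u) with after u
    ... | inj₁ _ = refl
    ... | inj₂ _ = refl
    vtx-prec : ∀ p → proj₂ (prec p) ≡ prevV (proj₂ p)
    vtx-prec (k , u) with before u
    ... | inj₁ _ = refl
    ... | inj₂ _ = refl
    up-succ : ∀ p → up (succ p) ≡ succ (up p)
    up-succ (k , u) with after u
    ... | inj₁ _ = refl
    ... | inj₂ _ = refl

theorem4p2 : (n : ℕ) (G : Graph n) → TwinFreeGraph G → Connected G → IsPCA G →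
    ¬ ComplementBipartite G → TwinFreeHyp (H′ G) × StrictlyOverlapConnected (H′ G)
theorem4p2 n G tf conn (A , intersect , proper) ncb =
  twin-free position , overlap-connected position
  where
  open ArcModel G A intersect proper using (roundModel)
  open Connectivity G tf conn ncb roundModel
  position : ∀ v → ∃ λ x → proj₂ x ≡ v
  position v = (0ℤ , v) , refl
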